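{- Let $p$ be a prime that is not a Wieferich prime. Then $M(p) = M(p^k)$ for every positive integer $k$.
   Context: For a positive integer $m$, $s_2(m)$ denotes the number of $1$'s in the binary expansion of $m$ (the Hamming weight of $m$). For a positive integer $n$, $M(n) := \min_{k\ge 1} s_2(kn)$, the minimum being over all positive integers $k$. A prime $p$ is a Wieferich prime if $p^2 \mid 2^{p-1}-1$. -}

module Defs where

open import Data.Digit using (0b; 1b; Expansion; fromDigits; toDigits)
open import Data.Fin.Base using (zero; suc; toℕ; fromℕ<)
open import Data.Fin.Properties using (_≟_; pigeonhole; fromℕ<-injective)
open import Data.List.Base using ([]; _∷_; length; filter)
open import Data.Nat.Base
  using (ℕ; zero; suc; _+_; _*_; _∸_; _^_; _≤_; _<_; z≤n; s≤s; NonZero; >-nonZero⁻¹)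
open import Data.Nat.DivMod
  using (_%_; m%n<n; %-distribˡ-+; %-distribˡ-*)
open import Data.Nat.Divisibility using (_∣_; divides; n∣m*n; m%n≡0⇒n∣m; n∣m⇒m%n≡0)
open import Data.Nat.Induction using (Acc; acc; <-wellFounded)
open import Data.Nat.Primality using (Prime)
open import Data.Nat.Properties hiding (_≟_)
open import Data.Nat.Solver using (module +-*-Solver)
open import Data.Product.Base using (∃; ∃-syntax; ∃₂; _×_; _,_; proj₁; proj₂)
open import Data.Sum.Base using (inj₁; inj₂)
open import Relation.Binary.PropositionalEquality
  using (_≡_; refl; sym; trans; cong; cong₂; subst; subst₂)
open import Relation.Nullary.Decidable using (yes; no)
open import Relation.Nullary.Negation using (contradiction)

open +-*-Solver using (solve; _:+_; _:*_; _:=_; con)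

weight : Expansion 2 → ℕ
weight ds = length (filter (_≟ 1b) ds)

opaque
  s₂ : ℕ → ℕ
  s₂ m = weight (proj₁ (toDigits 2 m))

AttainedByMultiple : ℕ → ℕ → Set
AttainedByMultiple n w = ∃[ k ] 1 ≤ k × s₂ (k * n) ≡ w

IsMinimum : (ℕ → Set) → ℕ → Set
IsMinimum P m = P m × (∀ w → P w → m ≤ w)

WieferichPrime : ℕ → Set
WieferichPrime p = Prime p × p ^ 2 ∣ 2 ^ (p ∸ 1) ∸ 1

-- Expansions are not canonical (they may end in zeros), but the weight
-- depends only on the number represented.

private
  double-zero : ∀ m → m * 2 ≡ 0 → m ≡ 0
  double-zero zero _ = refl

  parity-clash : ∀ m n {A : Set} → m * 2 ≡ 1 + n * 2 → A
  parity-clash m n eq = contradiction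
    (trans (*-comm 2 m) (trans eq (cong suc (*-comm n 2)))) (even≢odd m n)

weight-unique : ∀ ds es → fromDigits ds ≡ fromDigits es → weight ds ≡ weight es
weight-unique []              []              _  = refl
weight-unique []              (zero ∷ es)     eq =
  weight-unique [] es (sym (double-zero _ (sym eq)))
weight-unique (zero ∷ ds)     []              eq =
  weight-unique ds [] (double-zero _ eq)
weight-unique (zero ∷ ds)     (zero ∷ es)     eq =
  weight-unique ds es (*-cancelʳ-≡ _ _ 2 eq)
weight-unique (zero ∷ ds)     (suc zero ∷ es) eq =
  parity-clash (fromDigits ds) (fromDigits es) eq
weight-unique (suc zero ∷ ds) (zero ∷ es)     eq =
  parity-clash (fromDigits es) (fromDigits ds) (sym eq)
weight-unique (suc zero ∷ ds) (suc zero ∷ es) eq =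
  cong suc (weight-unique ds es (*-cancelʳ-≡ _ _ 2 (suc-injective eq)))

opaque
  unfolding s₂

  s₂-fromDigits : ∀ ds → s₂ (fromDigits ds) ≡ weight ds
  s₂-fromDigits ds =
    weight-unique (proj₁ (toDigits 2 (fromDigits ds))) ds
      (proj₂ (toDigits 2 (fromDigits ds)))

s₂-double : ∀ m → s₂ (m * 2) ≡ s₂ m
s₂-double m with toDigits 2 m
... | ds , refl = trans (s₂-fromDigits (0b ∷ ds)) (sym (s₂-fromDigits ds))

s₂-double+1 : ∀ m → s₂ (1 + m * 2) ≡ 1 + s₂ m
s₂-double+1 m with toDigits 2 m
... | ds , refl =
  trans (s₂-fromDigits (1b ∷ ds)) (cong suc (sym (s₂-fromDigits ds)))

private
  increment : ∀ ds → ∃[ fs ] fromDigits fs ≡ 1 + fromDigits ds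
                           × weight fs ≤ 1 + weight ds
  increment []              = 1b ∷ [] , refl , ≤-refl
  increment (zero ∷ ds)     = 1b ∷ ds , refl , ≤-refl
  increment (suc zero ∷ ds) with increment ds
  ... | fs , eq , le = 0b ∷ fs , cong (_* 2) eq , m≤n⇒m≤1+n le

  add : ∀ ds es → ∃[ fs ] fromDigits fs ≡ fromDigits ds + fromDigits es
                        × weight fs ≤ weight ds + weight es
  add []       es = es , refl , ≤-refl
  add (d ∷ ds) [] =
    d ∷ ds , sym (+-identityʳ _) , ≤-reflexive (sym (+-identityʳ _))
  add (zero ∷ ds) (zero ∷ es) with add ds es
  ... | fs , eq , le = 0b ∷ fs
    , trans (cong (_* 2) eq) (*-distribʳ-+ 2 (fromDigits ds) (fromDigits es))
    , le
  add (zero ∷ ds) (suc zero ∷ es) with add ds es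
  ... | fs , eq , le = 1b ∷ fs
    , trans (cong (λ x → 1 + x * 2) eq)
        (solve 2 (λ a b → con 1 :+ (a :+ b) :* con 2
                       := a :* con 2 :+ (con 1 :+ b :* con 2)) refl
          (fromDigits ds) (fromDigits es))
    , ≤-trans (s≤s le) (≤-reflexive (sym (+-suc _ _)))
  add (suc zero ∷ ds) (zero ∷ es) with add ds es
  ... | fs , eq , le = 1b ∷ fs
    , cong suc (trans (cong (_* 2) eq)
        (*-distribʳ-+ 2 (fromDigits ds) (fromDigits es)))
    , s≤s le
  add (suc zero ∷ ds) (suc zero ∷ es) with add ds es
  ... | fs , eq , le with increment fs
  ... | gs , eq′ , le′ = 0b ∷ gs
    , trans (cong (_* 2) (trans eq′ (cong suc eq)))
        (solve 2 (λ a b → (con 1 :+ (a :+ b)) :* con 2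
                       := (con 1 :+ a :* con 2) :+ (con 1 :+ b :* con 2)) refl
          (fromDigits ds) (fromDigits es))
    , ≤-trans le′ (s≤s (≤-trans le (+-monoʳ-≤ (weight ds) (n≤1+n _))))

s₂-subadditive : ∀ m n → s₂ (m + n) ≤ s₂ m + s₂ n
s₂-subadditive m n with toDigits 2 m | toDigits 2 n
... | ds , refl | es , refl with add ds es
... | fs , eq , le =
  subst₂ _≤_ (trans (sym (s₂-fromDigits fs)) (cong s₂ eq))
    (sym (cong₂ _+_ (s₂-fromDigits ds) (s₂-fromDigits es))) le

s₂-*2^ : ∀ m i → s₂ (m * 2 ^ i) ≡ s₂ m
s₂-*2^ m zero    = cong s₂ (*-identityʳ m)
s₂-*2^ m (suc i) =
  trans (cong s₂ (solve 2 (λ a b → a :* (con 2 :* b) := (a :* b) :* con 2) refl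
                   m (2 ^ i)))
        (trans (s₂-double (m * 2 ^ i)) (s₂-*2^ m i))

-- The minimum over all multiples of n exists: if 2 ^ i ≡ 2 ^ j (mod n) with
-- i < j, replacing q * 2 ^ j + r by q * 2 ^ i + r yields a smaller positive
-- multiple of n whose weight is no larger, so multiples below 2 ^ j suffice.

private
  Split : ℕ → ℕ → Set
  Split j x = ∃₂ λ q r → x ≡ q * 2 ^ j + r × r < 2 ^ j × s₂ q + s₂ r ≤ s₂ x

  split : ∀ j x → Split j x
  split zero x = x , 0
    , sym (trans (+-identityʳ _) (*-identityʳ x)) , ≤-refl
    , ≤-reflexive (trans (cong (s₂ x +_) (s₂-fromDigits [])) (+-identityʳ (s₂ x)))
  split (suc j) x with split j x
  ... | q , r , x≡ , r< , le with toDigits 2 q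
  ... | [] , refl = 0 , r , x≡ , ≤-trans r< (m≤m+n _ _) , le
  ... | zero ∷ ds , refl = fromDigits ds , r
    , trans x≡ (solve 3 (λ a b c → a :* con 2 :* b :+ c := a :* (con 2 :* b) :+ c)
                 refl (fromDigits ds) (2 ^ j) r)
    , ≤-trans r< (m≤m+n _ _)
    , subst (λ w → w + s₂ r ≤ s₂ x) (s₂-double (fromDigits ds)) le
  ... | suc zero ∷ ds , refl = fromDigits ds , 2 ^ j + r
    , trans x≡ (solve 3 (λ a b c → (con 1 :+ a :* con 2) :* b :+ c
                                := a :* (con 2 :* b) :+ (b :+ c))
                 refl (fromDigits ds) (2 ^ j) r)
    , subst (2 ^ j + r <_) (cong (2 ^ j +_) (sym (+-identityʳ _)))
        (+-monoʳ-< (2 ^ j) r<)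
    , (begin
      s₂ (fromDigits ds) + s₂ (2 ^ j + r)
        ≤⟨ +-monoʳ-≤ (s₂ (fromDigits ds)) (s₂-subadditive (2 ^ j) r) ⟩
      s₂ (fromDigits ds) + (s₂ (2 ^ j) + s₂ r)
        ≡⟨ cong (λ w → s₂ (fromDigits ds) + (w + s₂ r))
             (trans (cong s₂ (sym (*-identityˡ (2 ^ j))))
               (trans (s₂-*2^ 1 j) (s₂-fromDigits (1b ∷ [])))) ⟩
      s₂ (fromDigits ds) + (1 + s₂ r)
        ≡⟨ +-suc (s₂ (fromDigits ds)) (s₂ r) ⟩
      1 + s₂ (fromDigits ds) + s₂ r
        ≡⟨ cong (_+ s₂ r) (s₂-double+1 (fromDigits ds)) ⟨
      s₂ (1 + fromDigits ds * 2) + s₂ r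
        ≤⟨ le ⟩
      s₂ x ∎)
    where open ≤-Reasoning

  module _ (n : ℕ) .{{_ : NonZero n}} where

    powers-repeat : ∃₂ λ i j → i < j × 2 ^ i % n ≡ 2 ^ j % n
    powers-repeat
      with pigeonhole (n<1+n n) (λ i → fromℕ< (m%n<n (2 ^ toℕ i) n))
    ... | i , j , i<j , eq =
      toℕ i , toℕ j , i<j , fromℕ<-injective _ _ _ _ eq

    %-replace : ∀ q r {a b} → a % n ≡ b % n → (q * a + r) % n ≡ (q * b + r) % n
    %-replace q r {a} {b} eq =
      trans (%-distribˡ-+ (q * a) r n)
        (trans (cong (λ z → (z + r % n) % n)
                 (trans (%-distribˡ-* q a n)
                   (trans (cong (λ z → (q % n * z) % n) eq)
                     (sym (%-distribˡ-* q b n)))))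
          (sym (%-distribˡ-+ (q * b) r n)))

    module _ {i j} (i<j : i < j) (eq : 2 ^ i % n ≡ 2 ^ j % n) where

      descend : ∀ x → Acc _<_ x → 1 ≤ x → n ∣ x →
                ∃[ y ] 1 ≤ y × y < 2 ^ j × n ∣ y × s₂ y ≤ s₂ x
      descend x (acc rec) x≥1 n∣x with split j x
      ... | zero , r , refl , r< , _ = x , x≥1 , r< , n∣x , ≤-refl
      ... | q@(suc _) , r , refl , _ , le
        with descend (q * 2 ^ i + r) (rec x′<x) x′≥1 n∣x′
        where
        x′<x : q * 2 ^ i + r < q * 2 ^ j + r
        x′<x = +-monoˡ-< r (*-monoʳ-< q (^-monoʳ-< 2 (s≤s (s≤s z≤n)) i<j))
        x′≥1 : 1 ≤ q * 2 ^ i + r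
        x′≥1 = ≤-trans (*-mono-≤ {1} {q} (s≤s z≤n) (m^n>0 2 i)) (m≤m+n _ r)
        n∣x′ : n ∣ q * 2 ^ i + r
        n∣x′ = m%n≡0⇒n∣m _ n
          (trans (%-replace q r eq) (n∣m⇒m%n≡0 _ n n∣x))
      ... | y , y≥1 , y< , n∣y , le′ = y , y≥1 , y< , n∣y
        , ≤-trans le′ (≤-trans (s₂-subadditive (q * 2 ^ i) r)
            (≤-trans (≤-reflexive (cong (_+ s₂ r) (s₂-*2^ q i))) le))

  least : (f : ℕ → ℕ) (b : ℕ) →
          ∃[ k ] 1 ≤ k × (∀ l → 1 ≤ l → l ≤ 1 + b → f k ≤ f l)
  least f zero =
    1 , ≤-refl , λ l l≥1 l≤1 → ≤-reflexive (cong f (≤-antisym l≥1 l≤1))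
  least f (suc b) with least f b
  ... | k , k≥1 , min with ≤-total (f k) (f (2 + b))
  ... | inj₁ le = k , k≥1 , min′
    where
    min′ : ∀ l → 1 ≤ l → l ≤ 2 + b → f k ≤ f l
    min′ l l≥1 l≤ with m≤n⇒m<n∨m≡n l≤
    ... | inj₁ (s≤s l≤′) = min l l≥1 l≤′
    ... | inj₂ refl      = le
  ... | inj₂ ge = 2 + b , s≤s z≤n , min′
    where
    min′ : ∀ l → 1 ≤ l → l ≤ 2 + b → f (2 + b) ≤ f l
    min′ l l≥1 l≤ with m≤n⇒m<n∨m≡n l≤
    ... | inj₁ (s≤s l≤′) = ≤-trans ge (min l l≥1 l≤′)
    ... | inj₂ refl      = ≤-refl

minimum-exists : ∀ n .{{_ : NonZero n}} → ∃ (IsMinimum (AttainedByMultiple n))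
minimum-exists n with powers-repeat n
... | i , j , i<j , eq with least (λ k → s₂ (k * n)) (2 ^ j)
... | k , k≥1 , min = s₂ (k * n) , (k , k≥1 , refl) , lower
  where
  lower : ∀ w → AttainedByMultiple n w → s₂ (k * n) ≤ w
  lower _ (l , l≥1 , refl)
    with descend n i<j eq (l * n) (<-wellFounded _)
           (*-mono-≤ {1} {l} l≥1 (>-nonZero⁻¹ n)) (n∣m*n l)
  ... | .(c * n) , y≥1 , y< , divides c refl , le =
    ≤-trans (min c (c≥1 c y≥1) (≤-trans (m≤m*n c n) (≤-trans (<⇒≤ y<) (n≤1+n _)))) le
    where
    c≥1 : ∀ c → 1 ≤ c * n → 1 ≤ c
    c≥1 (suc _) _ = s≤s z≤n

opaque
  M : (n : ℕ) → .{{NonZero n}} → ℕ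
  M n = proj₁ (minimum-exists n)

  M-isMinimum : ∀ n .{{_ : NonZero n}} → IsMinimum (AttainedByMultiple n) (M n)
  M-isMinimum n = proj₂ (minimum-exists n)

{-# OPTIONS --safe #-}
-- Take a multiple of p of minimal weight and single out one of its binary
-- digits, writing it as 2 ^ a + R.  For p odd and not Wieferich, some power
-- 2 ^ e is 1 + u * p ^ k with p ∤ u, so multiplying a power of 2 by powers of
-- 2 ^ e reaches all its lifts modulo p ^ (1 + k).  Hence, as in Hensel's lemma,
-- the exponent a alone can be changed to some b with p ^ k ∣ 2 ^ b + R, and
-- subadditivity of the weight shows that no digits are gained.
module Submission where

open import Defs
open import Data.Digit using (1b; fromDigits; toDigits)
open import Data.Fin.Base using (zero; suc)
open import Data.List.Base using ([]; _∷_)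
open import Data.Nat.Base
  using (ℕ; zero; suc; _+_; _*_; _∸_; _^_; _≤_; _<_; z≤n; s≤s; NonZero; >-nonZero⁻¹;
         nonTrivial⇒n>1)
open import Data.Nat.Combinatorics
  using (_C_; nCk≡nC[n∸k]; nCn≡1; nC1≡n; k>n⇒nCk≡0; nCk+nC[k+1]≡[n+1]C[k+1])
open import Data.Nat.Coprimality using (Coprime; coprime-Bézout)
open import Data.Nat.Divisibility
  using (_∣_; divides; _∣0; 1∣_; >⇒∤; ∣-trans; ∣m∣n⇒∣m+n; ∣m+n∣m⇒∣n; m∣m*n; n∣m*n)
open import Data.Nat.GCD using (module Bézout)
open import Data.Nat.Primality
  using (Prime; prime⇒nonZero; prime⇒nonTrivial; prime⇒irreducible; euclidsLemma)
open import Data.Nat.Properties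
open import Data.Nat.Tactic.RingSolver using (solve-∀)
open import Data.Product.Base using (∃-syntax; ∃₂; _×_; _,_; proj₁; proj₂)
open import Data.Sum.Base using (inj₁; inj₂)
open import Function.Base using (_∘_)
open import Relation.Binary.PropositionalEquality
  using (_≡_; refl; sym; trans; cong; cong₂; subst; module ≡-Reasoning)
open import Relation.Nullary.Decidable using (yes; no)
open import Relation.Nullary.Negation using (¬_; contradiction)

-- Binomial coefficients divisible by a prime

nC0≡1 : ∀ n → n C 0 ≡ 1
nC0≡1 n = trans (nCk≡nC[n∸k] {0} {n} z≤n) (nCn≡1 n)

-- The absorption identity, kept free of division so that Euclid's lemma applies to it. It follows
-- from Pascal's rule by induction on the row.
[k+1]*[n+1]C[k+1]≡[n+1]*nCk : ∀ n k → suc k * (suc n C suc k) ≡ suc n * (n C k)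
[k+1]*[n+1]C[k+1]≡[n+1]*nCk n zero = begin
  1 * (suc n C 1)  ≡⟨ *-identityˡ _ ⟩
  suc n C 1        ≡⟨ nC1≡n (suc n) ⟩
  suc n            ≡⟨ *-identityʳ _ ⟨
  suc n * 1        ≡⟨ cong (suc n *_) (nC0≡1 n) ⟨
  suc n * (n C 0)  ∎
  where open ≡-Reasoning
[k+1]*[n+1]C[k+1]≡[n+1]*nCk zero (suc k) = begin
  suc (suc k) * (1 C suc (suc k))
    ≡⟨ cong (suc (suc k) *_) (k>n⇒nCk≡0 (s≤s (s≤s (z≤n {k})))) ⟩
  suc (suc k) * 0
    ≡⟨ *-zeroʳ (suc (suc k)) ⟩
  0
    ≡⟨ cong (1 *_) (k>n⇒nCk≡0 (s≤s (z≤n {k}))) ⟨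
  1 * (0 C suc k) ∎
  where open ≡-Reasoning
[k+1]*[n+1]C[k+1]≡[n+1]*nCk (suc n) (suc k) = begin
  suc (suc k) * (suc (suc n) C suc (suc k))
    ≡⟨ cong (suc (suc k) *_) (nCk+nC[k+1]≡[n+1]C[k+1] (suc n) (suc k)) ⟨
  suc (suc k) * (x + y)
    ≡⟨ expand (suc k) x y ⟩
  x + (suc k * x + suc (suc k) * y)
    ≡⟨ cong (x +_) (cong₂ _+_ ([k+1]*[n+1]C[k+1]≡[n+1]*nCk n k)
                              ([k+1]*[n+1]C[k+1]≡[n+1]*nCk n (suc k))) ⟩
  x + (suc n * (n C k) + suc n * (n C suc k))
    ≡⟨ cong (x +_) (*-distribˡ-+ (suc n) (n C k) (n C suc k)) ⟨
  x + suc n * (n C k + n C suc k)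
    ≡⟨ cong (λ z → x + suc n * z) (nCk+nC[k+1]≡[n+1]C[k+1] n k) ⟩
  x + suc n * x ∎
  where
  open ≡-Reasoning
  x = suc n C suc k
  y = suc n C suc (suc k)
  expand : ∀ k x y → suc k * (x + y) ≡ x + (k * x + suc k * y)
  expand = solve-∀

-- By absorption `p` divides `k * (p C k)`, and it cannot divide the smaller positive factor `k`.
p∣pCk : ∀ {p k} → Prime p → 1 ≤ k → k < p → p ∣ p C k
p∣pCk {suc q} {suc k} p-prime _ k<p
  with euclidsLemma (suc k) (suc q C suc k) p-prime
         (divides (q C k) (trans ([k+1]*[n+1]C[k+1]≡[n+1]*nCk q k) (*-comm (suc q) (q C k))))
... | inj₁ p∣k = contradiction p∣k (>⇒∤ k<p)
... | inj₂ p∣C = p∣C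

-- Row sums and Fermat's little theorem for base 2

-- Cutting the row short allows induction along it, and leaves out the last entry `p C p` when only
-- the inner entries matter.
binomialSum : ℕ → ℕ → ℕ
binomialSum n zero    = 0
binomialSum n (suc m) = n C m + binomialSum n m

binomialSum-Pascal : ∀ n m →
  binomialSum (suc n) (suc m) ≡ binomialSum n (suc m) + binomialSum n m
binomialSum-Pascal n zero = trans (cong (_+ 0) (trans (nC0≡1 (suc n)) (sym (nC0≡1 n))))
  (sym (+-identityʳ _))
binomialSum-Pascal n (suc m) = begin
  suc n C suc m + binomialSum (suc n) (suc m)
    ≡⟨ cong₂ _+_ (sym (nCk+nC[k+1]≡[n+1]C[k+1] n m)) (binomialSum-Pascal n m) ⟩
  (n C m + n C suc m) + (binomialSum n (suc m) + binomialSum n m)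
    ≡⟨ swap (n C m) (n C suc m) (binomialSum n (suc m)) (binomialSum n m) ⟩
  (n C suc m + binomialSum n (suc m)) + (n C m + binomialSum n m) ∎
  where
  open ≡-Reasoning
  swap : ∀ a b c d → (a + b) + (c + d) ≡ (b + c) + (a + d)
  swap = solve-∀

binomialSum-row : ∀ n → binomialSum n (suc n) ≡ 2 ^ n
binomialSum-row zero    = refl
binomialSum-row (suc n) = begin
  binomialSum (suc n) (suc (suc n))
    ≡⟨ binomialSum-Pascal n (suc n) ⟩
  (n C suc n + binomialSum n (suc n)) + binomialSum n (suc n)
    ≡⟨ cong (λ z → (z + binomialSum n (suc n)) + binomialSum n (suc n))
         (k>n⇒nCk≡0 (n<1+n n)) ⟩
  binomialSum n (suc n) + binomialSum n (suc n)
    ≡⟨ cong₂ _+_ (binomialSum-row n) (binomialSum-row n) ⟩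
  2 ^ n + 2 ^ n
    ≡⟨ cong (2 ^ n +_) (+-identityʳ (2 ^ n)) ⟨
  2 ^ suc n ∎
  where open ≡-Reasoning

binomialSum-prime : ∀ {p} → Prime p → ∀ m → m < p →
                    ∃[ v ] p ∣ v × binomialSum p (suc m) ≡ 1 + v
binomialSum-prime {p} p-prime zero m<p =
  0 , p ∣0 , trans (+-identityʳ _) (nC0≡1 p)
binomialSum-prime {p} p-prime (suc m) m<p
  with binomialSum-prime p-prime m (<-trans (n<1+n m) m<p)
... | v , p∣v , eq =
  p C suc m + v , ∣m∣n⇒∣m+n (p∣pCk p-prime (s≤s z≤n) m<p) p∣v
  , trans (cong (p C suc m +_) eq) (+-suc (p C suc m) v)

-- Row `p` sums to 2 ^ p, and its inner entries are all divisible by `p`; Euclid's lemma then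
-- cancels a factor 2.
p∣2^[p∸1]∸1 : ∀ {p} → Prime p → ¬ p ∣ 2 → p ∣ 2 ^ (p ∸ 1) ∸ 1
p∣2^[p∸1]∸1 {p@(suc q)} p-prime p∤2 with binomialSum-prime p-prime q (n<1+n q)
... | v , p∣v , eq with euclidsLemma 2 (2 ^ q ∸ 1) p-prime (subst (p ∣_) (sym twice) p∣v)
  where
  open ≡-Reasoning
  -- The 2 comes from the outer entries `p C p` and `p C 0`.
  2^p≡2+v : 2 * 2 ^ q ≡ 2 + v
  2^p≡2+v = trans (sym (binomialSum-row p)) (cong₂ _+_ (nCn≡1 p) eq)
  twice : 2 * (2 ^ q ∸ 1) ≡ v
  twice = trans (*-distribˡ-∸ 2 (2 ^ q) 1) (cong (_∸ 2) 2^p≡2+v)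
... | inj₁ p∣2 = contradiction p∣2 p∤2
... | inj₂ p∣  = p∣

-- Truncated binomial expansion and linear congruences

-- The quadratic coefficient stays explicit because `exactUnit-suc` needs its divisibility by `p`;
-- from the cubic term on, the power of `x` alone suffices.
binomial-cubic : ∀ x n → ∃[ v ]
  (1 + x) ^ n ≡ 1 + n * x + (n C 2) * (x * x) + v * (x * x * x)
binomial-cubic x zero    = 0 , refl
binomial-cubic x (suc n) with binomial-cubic x n
... | v , eq = v + n C 2 + v * x , (begin
  (1 + x) * (1 + x) ^ n
    ≡⟨ cong ((1 + x) *_) eq ⟩
  (1 + x) * (1 + n * x + (n C 2) * (x * x) + v * (x * x * x))
    ≡⟨ expand x n (n C 2) v ⟩
  1 + suc n * x + (n + n C 2) * (x * x) + (v + n C 2 + v * x) * (x * x * x)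
    ≡⟨ cong (λ z → 1 + suc n * x + z * (x * x) + (v + n C 2 + v * x) * (x * x * x))
         (trans (cong (_+ n C 2) (sym (nC1≡n n))) (nCk+nC[k+1]≡[n+1]C[k+1] n 1)) ⟩
  1 + suc n * x + (suc n C 2) * (x * x) + (v + n C 2 + v * x) * (x * x * x) ∎)
  where
  open ≡-Reasoning
  expand : ∀ x n c v → (1 + x) * (1 + n * x + c * (x * x) + v * (x * x * x))
         ≡ 1 + suc n * x + (n + c) * (x * x) + (v + c + v * x) * (x * x * x)
  expand = solve-∀

-- Bézout inverts `w` modulo `p` up to sign, and `t` is `c` times the negative of that inverse.
linear-congruence : ∀ {p w} → Prime p → ¬ p ∣ w → ∀ c → ∃[ t ] p ∣ c + t * w
linear-congruence {p@(suc q)} {w} p-prime p∤w c with coprime-Bézout coprime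
  where
  coprime : Coprime p w
  coprime (d∣p , d∣w) with prime⇒irreducible p-prime d∣p
  ... | inj₁ d≡1 = d≡1
  ... | inj₂ d≡p = contradiction (subst (_∣ w) d≡p d∣w) p∤w
... | Bézout.+- x y eq = c * y , divides (c * x) (begin
  c + c * y * w    ≡⟨ factor c y w ⟩
  c * (1 + y * w)  ≡⟨ cong (c *_) eq ⟩
  c * (x * p)      ≡⟨ *-assoc c x p ⟨
  c * x * p        ∎)
  where
  open ≡-Reasoning
  factor : ∀ c y w → c + c * y * w ≡ c * (1 + y * w)
  factor = solve-∀
-- Here `y` inverts `w` itself, so the factor `q`, which is p - 1, stands in for -1.
... | Bézout.-+ x y eq = q * c * y , divides (c + q * c * x) (begin
  c + q * c * y * w      ≡⟨ cong (c +_) (*-assoc (q * c) y w) ⟩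
  c + q * c * (y * w)    ≡⟨ cong (λ z → c + q * c * z) eq ⟨
  c + q * c * (1 + x * p) ≡⟨ factor c q x ⟩
  (c + q * c * x) * p    ∎)
  where
  open ≡-Reasoning
  factor : ∀ c q x → c + q * c * (1 + x * suc q) ≡ (c + q * c * x) * suc q
  factor = solve-∀

-- Powers of 2 that are exactly 1 modulo a prime power

-- For k ≥ 1 this says that 2 ^ e ≡ 1 modulo p ^ k but not modulo p ^ (1 + k).
ExactUnit : ℕ → ℕ → Set
ExactUnit p k = ∃₂ λ e u → 2 ^ e ≡ 1 + u * p ^ k × ¬ p ∣ u

-- With exponent p - 1 the cofactor `u` is the Fermat quotient of 2; were it divisible by `p`, then
-- `p` would be a Wieferich prime.
nonWieferich⇒exactUnit : ∀ {p} → Prime p → ¬ p ∣ 2 → ¬ WieferichPrime p → ExactUnit p 1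
nonWieferich⇒exactUnit {p} p-prime p∤2 ¬wieferich with p∣2^[p∸1]∸1 p-prime p∤2
... | divides u eq = p ∸ 1 , u
  , (begin
    2 ^ (p ∸ 1)            ≡⟨ m+[n∸m]≡n (m^n>0 2 (p ∸ 1)) ⟨
    1 + (2 ^ (p ∸ 1) ∸ 1)  ≡⟨ cong suc eq ⟩
    1 + u * p              ≡⟨ cong (λ z → 1 + u * z) (*-identityʳ p) ⟨
    1 + u * p ^ 1          ∎)
  , λ { (divides v refl) → ¬wieferich (p-prime , divides v (trans eq (square v p))) }
  where
  open ≡-Reasoning
  square : ∀ v p → v * p * p ≡ v * (p * (p * 1))
  square = solve-∀

-- Taking the `p`-th power multiplies the deviation from 1 by `p`, up to a multiple of p ^ (k + 3),
-- so the cofactor is unchanged modulo `p`. When `k` is 0 the quadratic term reaches that order only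
-- because 2 < p gives `p ∣ p C 2`.
exactUnit-suc : ∀ {p} k → Prime p → 2 < p → ExactUnit p (suc k) → ExactUnit p (suc (suc k))
exactUnit-suc {p} k p-prime 2<p (e , u , eq , p∤u)
  with binomial-cubic (u * p ^ suc k) p | p∣pCk p-prime (s≤s z≤n) 2<p
... | v , cubic | divides w pC2≡ = e * p , u + s * p
  , (begin
    2 ^ (e * p)  ≡⟨ ^-*-assoc 2 e p ⟨
    (2 ^ e) ^ p  ≡⟨ cong (_^ p) eq ⟩
    (1 + x) ^ p  ≡⟨ cubic ⟩
    1 + p * x + (p C 2) * (x * x) + v * (x * x * x)
      ≡⟨ cong (λ z → 1 + p * x + z * (x * x) + v * (x * x * x)) pC2≡ ⟩
    1 + p * x + (w * p) * (x * x) + v * (x * x * x)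
      ≡⟨ collect p u r v w ⟩
    1 + (u + s * p) * p ^ suc (suc k) ∎)
  , λ p∣ → p∤u (∣m+n∣m⇒∣n (subst (p ∣_) (+-comm u (s * p)) p∣) (n∣m*n s))
  where
  open ≡-Reasoning
  r = p ^ k
  x = u * p ^ suc k
  s = w * u * u * r + v * u * u * u * r * r
  collect : ∀ p u r v w →
    1 + p * (u * (p * r)) + (w * p) * ((u * (p * r)) * (u * (p * r)))
      + v * ((u * (p * r)) * (u * (p * r)) * (u * (p * r)))
    ≡ 1 + (u + (w * u * u * r + v * u * u * u * r * r) * p) * (p * (p * r))
  collect = solve-∀

exactUnit : ∀ {p} → Prime p → ¬ p ∣ 2 → 2 < p → ¬ WieferichPrime p →
            ∀ k → ExactUnit p (suc k)
exactUnit p-prime p∤2 2<p ¬wieferich zero    = nonWieferich⇒exactUnit p-prime p∤2 ¬wieferich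
exactUnit p-prime p∤2 2<p ¬wieferich (suc k) =
  exactUnit-suc k p-prime 2<p (exactUnit p-prime p∤2 2<p ¬wieferich k)

-- Lifting the exponent

prime∤2^ : ∀ {p} → Prime p → ¬ p ∣ 2 → ∀ b → ¬ p ∣ 2 ^ b
prime∤2^ p-prime p∤2 zero    p∣1 = p∤2 (∣-trans p∣1 (1∣ 2))
prime∤2^ p-prime p∤2 (suc b) p∣  with euclidsLemma 2 (2 ^ b) p-prime p∣
... | inj₁ p∣2  = p∤2 p∣2
... | inj₂ p∣2^ = prime∤2^ p-prime p∤2 b p∣2^

-- Replacing `b` by `b + e * t` changes the cofactor `c` to `c + t * (2 ^ b * u)` modulo `p`. Since
-- `p` does not divide `2 ^ b * u`, some `t` makes this vanish.
lift-exponent : ∀ {p} k b {R} → Prime p → ¬ p ∣ 2 → ExactUnit p (suc k) →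
                p ^ suc k ∣ 2 ^ b + R → ∃[ b′ ] p ^ suc (suc k) ∣ 2 ^ b′ + R
lift-exponent {p} k b {R} p-prime p∤2 (e , u , eq , p∤u) (divides c c≡)
  with linear-congruence p-prime p∤2^b*u c
  where
  p∤2^b*u : ¬ p ∣ 2 ^ b * u
  p∤2^b*u p∣ with euclidsLemma (2 ^ b) u p-prime p∣
  ... | inj₁ p∣2^b = prime∤2^ p-prime p∤2 b p∣2^b
  ... | inj₂ p∣u   = p∤u p∣u
... | t , divides d d≡ with binomial-cubic (u * p ^ suc k) t
... | v , cubic = b + e * t , divides (d + s) (begin
  2 ^ (b + e * t) + R
    ≡⟨ cong (_+ R) (^-distribˡ-+-* 2 b (e * t)) ⟩
  2 ^ b * 2 ^ (e * t) + R
    ≡⟨ cong (λ z → 2 ^ b * z + R) (^-*-assoc 2 e t) ⟨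
  2 ^ b * (2 ^ e) ^ t + R
    ≡⟨ cong (λ z → 2 ^ b * z ^ t + R) eq ⟩
  2 ^ b * (1 + x) ^ t + R
    ≡⟨ cong (λ z → 2 ^ b * z + R) cubic ⟩
  2 ^ b * (1 + t * x + (t C 2) * (x * x) + v * (x * x * x)) + R
    ≡⟨ isolate (2 ^ b) R t x (t C 2) v ⟩
  (2 ^ b + R) + 2 ^ b * (t * x + (t C 2) * (x * x) + v * (x * x * x))
    ≡⟨ cong (_+ 2 ^ b * (t * x + (t C 2) * (x * x) + v * (x * x * x))) c≡ ⟩
  c * p ^ suc k + 2 ^ b * (t * x + (t C 2) * (x * x) + v * (x * x * x))
    ≡⟨ collect c (2 ^ b) t u p r (t C 2) v ⟩
  (c + t * (2 ^ b * u)) * p ^ suc k + s * p ^ suc (suc k)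
    ≡⟨ cong (λ z → z * p ^ suc k + s * p ^ suc (suc k)) d≡ ⟩
  d * p * p ^ suc k + s * p ^ suc (suc k)
    ≡⟨ cong (_+ s * p ^ suc (suc k)) (*-assoc d p (p ^ suc k)) ⟩
  d * p ^ suc (suc k) + s * p ^ suc (suc k)
    ≡⟨ *-distribʳ-+ (p ^ suc (suc k)) d s ⟨
  (d + s) * p ^ suc (suc k) ∎)
  where
  open ≡-Reasoning
  r = p ^ k
  x = u * p ^ suc k
  -- Cofactor of the terms of order two and higher in `x`, which are multiples of p ^ (k + 2)
  -- because 2 * (k + 1) ≥ k + 2.
  s = 2 ^ b * r * u * u * (t C 2 + v * x)
  isolate : ∀ B R t x c v → B * (1 + t * x + c * (x * x) + v * (x * x * x)) + R
          ≡ (B + R) + B * (t * x + c * (x * x) + v * (x * x * x))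
  isolate = solve-∀
  collect : ∀ c B t u p r a v →
    c * (p * r) + B * (t * (u * (p * r)) + a * ((u * (p * r)) * (u * (p * r)))
      + v * ((u * (p * r)) * (u * (p * r)) * (u * (p * r))))
    ≡ (c + t * (B * u)) * (p * r)
      + (B * r * u * u * (a + v * (u * (p * r)))) * (p * (p * r))
  collect = solve-∀

hensel : ∀ {p} a {R} → Prime p → ¬ p ∣ 2 → 2 < p → ¬ WieferichPrime p →
         p ∣ 2 ^ a + R → ∀ k → ∃[ b ] p ^ suc k ∣ 2 ^ b + R
hensel {p} a {R} p-prime p∤2 2<p ¬wieferich p∣ zero =
  a , subst (_∣ 2 ^ a + R) (sym (*-identityʳ p)) p∣
hensel a p-prime p∤2 2<p ¬wieferich p∣ (suc k)
  with hensel a p-prime p∤2 2<p ¬wieferich p∣ k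
... | b , p^∣ =
  lift-exponent k b p-prime p∤2 (exactUnit p-prime p∤2 2<p ¬wieferich k) p^∣

-- Weights of multiples and comparison of minima

s₂-2^ : ∀ a → s₂ (2 ^ a) ≡ 1
s₂-2^ a = trans (cong s₂ (sym (*-identityˡ (2 ^ a))))
  (trans (s₂-*2^ 1 a) (s₂-fromDigits (1b ∷ [])))

-- The digit removed is the lowest 1. The weight equation is exact, leaving room for the one digit
-- that is put back elsewhere.
extract-digit : ∀ m → 1 ≤ m → ∃₂ λ a R → m ≡ 2 ^ a + R × s₂ m ≡ 1 + s₂ R
extract-digit m m≥1 with toDigits 2 m
... | ds , refl = go ds m≥1
  where
  go : ∀ ds → 1 ≤ fromDigits ds →
       ∃₂ λ a R → fromDigits ds ≡ 2 ^ a + R × s₂ (fromDigits ds) ≡ 1 + s₂ R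
  go (suc zero ∷ ds) _ =
    0 , fromDigits ds * 2 , refl
    , trans (s₂-double+1 (fromDigits ds)) (cong suc (sym (s₂-double (fromDigits ds))))
  go (zero ∷ ds) 2m≥1 with go ds (m*n>0⇒m>0 (fromDigits ds) 2m≥1)
    where
    m*n>0⇒m>0 : ∀ m {n} → 1 ≤ m * n → 1 ≤ m
    m*n>0⇒m>0 (suc m) _ = s≤s z≤n
  ... | a , R , eq , weight-eq = suc a , R * 2
    , trans (cong (_* 2) eq)
        (trans (*-distribʳ-+ 2 (2 ^ a) R) (cong (_+ R * 2) (*-comm (2 ^ a) 2)))
    , trans (s₂-double (fromDigits ds))
        (trans weight-eq (cong suc (sym (s₂-double R))))

M-attained : ∀ n .{{_ : NonZero n}} → ∃[ m ] 1 ≤ m × n ∣ m × s₂ m ≡ M n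
M-attained n with proj₁ (M-isMinimum n)
... | k@(suc _) , k≥1 , eq = k * n , *-mono-≤ k≥1 (>-nonZero⁻¹ n) , n∣m*n k , eq

M≤s₂ : ∀ n .{{_ : NonZero n}} {m} → 1 ≤ m → n ∣ m → M n ≤ s₂ m
M≤s₂ n 1≤m (divides k@(suc _) refl) = proj₂ (M-isMinimum n) _ (k , s≤s z≤n , refl)

-- Multiples of `n` are multiples of `m`, so the minimum for `m` ranges over more numbers. With `p`
-- dividing its powers this is the easy inequality.
M-mono-∣ : ∀ {m n} .{{_ : NonZero m}} .{{_ : NonZero n}} → m ∣ n → M m ≤ M n
M-mono-∣ {m} {n} m∣n with M-attained n
... | l , l≥1 , n∣l , eq = subst (M m ≤_) eq (M≤s₂ m l≥1 (∣-trans m∣n n∣l))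

M-2^ : ∀ k .{{_ : NonZero (2 ^ k)}} → M (2 ^ k) ≤ M 2
M-2^ k with M-attained 2
... | l@(suc _) , l≥1 , _ , eq =
  subst (M (2 ^ k) ≤_) (trans (s₂-*2^ l k) eq)
    (M≤s₂ (2 ^ k) (*-mono-≤ l≥1 (m^n>0 2 k)) (n∣m*n l))

M-prime-power-≤ : ∀ p k .{{_ : NonZero p}} .{{_ : NonZero (p ^ suc k)}} →
  Prime p → ¬ WieferichPrime p → M (p ^ suc k) ≤ M p
M-prime-power-≤ p k p-prime ¬wieferich with p ≟ 2
... | yes refl = M-2^ (suc k)
... | no p≢2 with M-attained p
... | l , l≥1 , p∣l , eq with extract-digit l l≥1
... | a , R , refl , weight-eq
  with hensel a p-prime p∤2 2<p ¬wieferich p∣l k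
  where
  2<p : 2 < p
  2<p = ≤∧≢⇒< (nonTrivial⇒n>1 p {{prime⇒nonTrivial p-prime}}) (p≢2 ∘ sym)
  p∤2 : ¬ p ∣ 2
  p∤2 = >⇒∤ 2<p
... | b , p^∣ = begin
  M (p ^ suc k)       ≤⟨ M≤s₂ (p ^ suc k) (≤-trans (m^n>0 2 b) (m≤m+n (2 ^ b) R)) p^∣ ⟩
  -- Only an inequality: `R` may already have a 1 at position `b`, and the carry can then lower the
  -- weight.
  s₂ (2 ^ b + R)      ≤⟨ s₂-subadditive (2 ^ b) R ⟩
  s₂ (2 ^ b) + s₂ R   ≡⟨ cong (_+ s₂ R) (s₂-2^ b) ⟩
  1 + s₂ R            ≡⟨ weight-eq ⟨
  s₂ (2 ^ a + R)      ≡⟨ eq ⟩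
  M p                 ∎
  where open ≤-Reasoning

theorem2 : (p : ℕ) (p-prime : Prime p) → ¬ WieferichPrime p → (k : ℕ) → 1 ≤ k →
    M p {{prime⇒nonZero p-prime}} ≡ M (p ^ k) {{m^n≢0 p k {{prime⇒nonZero p-prime}}}}
theorem2 p p-prime ¬wieferich (suc k) _ =
  ≤-antisym (M-mono-∣ (m∣m*n (p ^ k))) (M-prime-power-≤ p k p-prime ¬wieferich)
  where
  instance
    p≢0 : NonZero p
    p≢0 = prime⇒nonZero p-prime
    p^≢0 : NonZero (p ^ suc k)
    p^≢0 = m^n≢0 p (suc k)
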